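{- The following two statements are equivalent. (1) (Sensitivity Conjecture) There exists a univariate real polynomial $p$ such that for every $n\ge 1$ and every Boolean function $f:\{0,1\}^n\to\{0,1\}$, $bs(f)\le p(s(f))$. (2) There exists a univariate real polynomial $q$ such that for every $n\ge 1$ and every Boolean function $f:\{0,1\}^n\to\{0,1\}$, $D_\oplus(f)\le q(s(f))$.
   Context: For $B\subseteq[n]=\{1,\dots,n\}$ let $e_B\in\{0,1\}^n$ be the characteristic vector of $B$, and let $e_i=e_{\{i\}}$. Let $\oplus$ denote bitwise XOR on $\{0,1\}^n$. For $f$ on $\{0,1\}^n$ and $x\in\{0,1\}^n$, the sensitivity $s(f,x)$ is the number of $i\in[n]$ with $f(x\oplus e_i)\ne f(x)$, and $s(f)=\max_x s(f,x)$. A block $B\subseteq[n]$ is sensitive for $f$ on $x$ if $f(x\oplus e_B)\neq f(x)$. The block sensitivity $bs(f,x)$ is the maximum number of pairwise disjoint sensitive blocks of $f$ on $x$, and $bs(f)=\max_x bs(f,x)$. A parity decision tree on variables $x_1,\dots,x_n$ is a rooted binary tree in which each internal node is labeled by a subset $T\subseteq[n]$, the two edges from each internal node to its children are labeled $0$ and $1$, and each leaf is labeled $0$ or $1$. On input $x$, evaluation starts at the root; at a node labeled $T$ one queries $\sum_{i\in T}x_i \bmod 2$ and follows the edge labeled with the outcome, until a leaf is reached, whose label is the output. The tree computes $f$ if its output is $f(x)$ for every $x\in\{0,1\}^n$. The parity decision tree complexity $D_\oplus(f)$ is the minimum depth of a parity decision tree computing $f$. The polynomials $p$ and $q$ do not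 depend on $n$ or $f$. -}

module Defs where

open import Data.Bool.Base using (Bool; true; false; if_then_else_; _xor_)
import Data.Bool.Properties as Bool
open import Data.Fin.Base using (Fin; zero; suc)
open import Data.Fin.Properties using (injective⇒≤)
open import Data.Fin.Subset using (Subset; ⁅_⁆; ⊥; _∩_; Empty; Nonempty; outside)
open import Data.Fin.Subset.Properties
  using (anySubset?; nonempty?; x∈p∩q⁺; Empty-unique)
open import Data.Integer.Base using (+_)
open import Data.List.Base using (List; []; _∷_; length; filter; allFin)
open import Data.Nat.Base as ℕ using (ℕ; zero; suc; _⊔_)
import Data.Nat.Properties as ℕ
open import Data.Product.Base using (∃; ∃-syntax; _×_; _,_; proj₁; proj₂)
open import Data.Rational.Base as ℚ
  using (ℚ; 0ℚ; 1ℚ; ½; ∣_∣; Positive; _-_; 1/_; _/_)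
import Data.Rational.Properties as ℚ
open import Data.Rational.Solver using (module +-*-Solver)
open import Data.Sum.Base using (inj₁; inj₂; [_,_]′)
open import Data.Vec.Base as Vec using (Vec; []; _∷_; zipWith; foldr′)
import Data.Vec.Properties as Vec
open import Data.Vec.Relation.Unary.All as All using (All; []; _∷_)
open import Data.Vec.Relation.Unary.AllPairs as AllPairs using (AllPairs; []; _∷_)
open import Function.Base using (_∘_)
open import Relation.Binary.PropositionalEquality
  using (_≡_; _≢_; refl; sym; trans; cong; subst)
open import Relation.Nullary.Decidable
  using (Dec; yes; no; map′; ¬?; _×-dec_; _⊎-dec_; decidable-stable)
open import Relation.Nullary.Negation using (contradiction)
open import Relation.Unary using (Decidable)

private
  variable
    n k : ℕ

record Maximum (P : ℕ → Set) : Set where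
  field
    value    : ℕ
    attained : P value
    bound    : ∀ {m} → P m → m ℕ.≤ value

record Minimum (P : ℕ → Set) : Set where
  field
    value    : ℕ
    attained : P value
    bound    : ∀ {m} → P m → value ℕ.≤ m

maximum : {P : ℕ → Set} → Decidable P → ∃ P →
          ∀ b → (∀ {m} → P m → m ℕ.≤ b) → Maximum P
maximum P? (m , Pm) b P≤b with P? b
... | yes Pb = record { value = b ; attained = Pb ; bound = P≤b }
maximum {P} P? (m , Pm) zero P≤b | no ¬Pb =
  contradiction (subst P (ℕ.n≤0⇒n≡0 (P≤b Pm)) Pm) ¬Pb
maximum {P} P? (m , Pm) (suc b) P≤b | no ¬Pb =
  maximum P? (m , Pm) b λ Pk → ℕ.s≤s⁻¹ (ℕ.≤∧≢⇒< (P≤b Pk) λ { refl → ¬Pb Pk })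

minimum : {P : ℕ → Set} → Decidable P → ∀ m → P m → Minimum P
minimum P? zero P0 = record { value = 0 ; attained = P0 ; bound = λ _ → ℕ.z≤n }
minimum {P} P? (suc m) Pm with P? 0
... | yes P0 = record { value = 0 ; attained = P0 ; bound = λ _ → ℕ.z≤n }
... | no ¬P0 = record
  { value    = suc value
  ; attained = attained
  ; bound    = λ { {zero} P0 → contradiction P0 ¬P0 ; {suc _} Pk → ℕ.s≤s (bound Pk) }
  }
  where open Minimum (minimum (P? ∘ suc) m Pm)

-- As `Subset n` is `Vec Bool n`, a block B is its own characteristic
-- vector e_B.
BoolFun : ℕ → Set
BoolFun n = Vec Bool n → Bool

infixl 6 _⊕_

_⊕_ : Vec Bool n → Vec Bool n → Vec Bool n
_⊕_ = zipWith _xor_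

⊕-identityʳ : (x : Vec Bool n) → x ⊕ ⊥ ≡ x
⊕-identityʳ = Vec.zipWith-identityʳ Bool.xor-identityʳ

cubeMax : (Vec Bool n → ℕ) → ℕ
cubeMax {zero}  g = g []
cubeMax {suc n} g = cubeMax (g ∘ (false ∷_)) ⊔ cubeMax (g ∘ (true ∷_))

Sensitive : BoolFun n → Vec Bool n → Subset n → Set
Sensitive f x B = f (x ⊕ B) ≢ f x

sensitive? : (f : BoolFun n) (x : Vec Bool n) → Decidable (Sensitive f x)
sensitive? f x B = ¬? (f (x ⊕ B) Bool.≟ f x)

sensitivityAt : BoolFun n → Vec Bool n → ℕ
sensitivityAt {n} f x = length (filter (λ i → sensitive? f x ⁅ i ⁆) (allFin n))

s : BoolFun n → ℕ
s f = cubeMax (sensitivityAt f)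

Disjoint : Subset n → Subset n → Set
Disjoint B C = Empty (B ∩ C)

SensitiveFamily : BoolFun n → Vec Bool n → ℕ → Set
SensitiveFamily {n} f x k =
  ∃[ Bs ] All (Sensitive f x) Bs × AllPairs Disjoint {k} Bs

anyFamily? : ∀ k {P : Vec (Subset n) k → Set} → Decidable P → Dec (∃ P)
anyFamily? zero    P? = map′ ([] ,_) (λ { ([] , p) → p }) (P? [])
anyFamily? (suc k) P? =
  map′ (λ { (B , Bs , p) → B ∷ Bs , p }) (λ { (B ∷ Bs , p) → B , Bs , p })
    (anySubset? λ B → anyFamily? k (P? ∘ (B ∷_)))

sensitiveFamily? : (f : BoolFun n) (x : Vec Bool n) → Decidable (SensitiveFamily f x)
sensitiveFamily? f x k = anyFamily? k λ Bs →
  All.all? (sensitive? f x) Bs ×-dec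
  AllPairs.allPairs? (λ B C → ¬? (nonempty? (B ∩ C))) Bs

sensitive⇒nonempty : (f : BoolFun n) (x : Vec Bool n) {B : Subset n} →
                     Sensitive f x B → Nonempty B
sensitive⇒nonempty f x {B} sens = decidable-stable (nonempty? B) λ empty →
  sens (trans (cong (f ∘ (x ⊕_)) (Empty-unique empty)) (cong f (⊕-identityʳ x)))

disjoint-family≤n : {Bs : Vec (Subset n) k} →
                    All Nonempty Bs → AllPairs Disjoint Bs → k ℕ.≤ n
disjoint-family≤n {n} ne dis = injective⇒≤ (pick-injective ne dis)
  where
  pick : ∀ {k} {Bs : Vec (Subset n) k} → All Nonempty Bs → Fin k → Fin n
  pick ((j , _) ∷ _) zero    = j
  pick (_ ∷ ne)      (suc i) = pick ne i

  pick-apart : ∀ {k B} {Bs : Vec (Subset n) k} (b : Nonempty B)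
               (ne : All Nonempty Bs) → All (Disjoint B) Bs →
               ∀ i → proj₁ b ≢ pick ne i
  pick-apart (j , j∈B) ((_ , j∈C) ∷ _) (dis ∷ _) zero refl = dis (j , x∈p∩q⁺ (j∈B , j∈C))
  pick-apart b (_ ∷ ne) (_ ∷ dis) (suc i) eq = pick-apart b ne dis i eq

  pick-injective : ∀ {k} {Bs : Vec (Subset n) k} (ne : All Nonempty Bs) →
                   AllPairs Disjoint Bs → ∀ {i j} → pick ne i ≡ pick ne j → i ≡ j
  pick-injective _ _ {zero} {zero} _ = refl
  pick-injective (b ∷ ne) (d ∷ _) {zero} {suc j} eq = contradiction eq (pick-apart b ne d j)
  pick-injective (b ∷ ne) (d ∷ _) {suc i} {zero} eq = contradiction (sym eq) (pick-apart b ne d i)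
  pick-injective (_ ∷ ne) (_ ∷ ds) {suc i} {suc j} eq = cong suc (pick-injective ne ds eq)

maxSensitiveFamily : (f : BoolFun n) (x : Vec Bool n) → Maximum (SensitiveFamily f x)
maxSensitiveFamily {n} f x =
  maximum (sensitiveFamily? f x) (0 , [] , [] , []) n
    λ { (_ , sens , dis) → disjoint-family≤n (All.map (sensitive⇒nonempty f x) sens) dis }

blockSensitivityAt : BoolFun n → Vec Bool n → ℕ
blockSensitivityAt f x = Maximum.value (maxSensitiveFamily f x)

bs : BoolFun n → ℕ
bs f = cubeMax (blockSensitivityAt f)

-- In `node T t₀ t₁`, the edge labelled b leads to t_b.
data ParityTree (n : ℕ) : Set where
  leaf : Bool → ParityTree n
  node : Subset n → ParityTree n → ParityTree n → ParityTree n

parity : Subset n → Vec Bool n → Bool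
parity T x = foldr′ _xor_ false (T ∩ x)

output : ParityTree n → BoolFun n
output (leaf b)       x = b
output (node T t₀ t₁) x = if parity T x then output t₁ x else output t₀ x

depth : ParityTree n → ℕ
depth (leaf _)       = 0
depth (node _ t₀ t₁) = suc (depth t₀ ⊔ depth t₁)

Computes : ParityTree n → BoolFun n → Set
Computes t f = ∀ x → output t x ≡ f x

ComputableInDepth : BoolFun n → ℕ → Set
ComputableInDepth f d = ∃[ t ] depth t ≡ d × Computes t f

computes? : (t : ParityTree n) (f : BoolFun n) → Dec (Computes t f)
computes? t f =
  map′ (λ ¬∃ x → decidable-stable (output t x Bool.≟ f x) (λ neq → ¬∃ (x , neq)))
       (λ ∀≡ (x , neq) → neq (∀≡ x))
       (¬? (anySubset? λ x → ¬? (output t x Bool.≟ f x)))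

anyTree? : ∀ d {P : ParityTree n → Set} → Decidable P →
           Dec (∃[ t ] depth t ℕ.≤ d × P t)
anyTree? zero P? =
  map′ [ (λ p → leaf false , ℕ.z≤n , p) , (λ p → leaf true , ℕ.z≤n , p) ]′
       (λ { (leaf false , _ , p) → inj₁ p ; (leaf true , _ , p) → inj₂ p })
       (P? (leaf false) ⊎-dec P? (leaf true))
anyTree? (suc d) P? =
  map′ [ [ (λ p → leaf false , ℕ.z≤n , p) , (λ p → leaf true , ℕ.z≤n , p) ]′
       , (λ { (T , t₀ , d₀ , t₁ , d₁ , p) → node T t₀ t₁ , ℕ.s≤s (ℕ.⊔-lub d₀ d₁) , p }) ]′
       (λ { (leaf false , _ , p) → inj₁ (inj₁ p)
          ; (leaf true  , _ , p) → inj₁ (inj₂ p)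
          ; (node T t₀ t₁ , ℕ.s≤s d₀⊔d₁ , p) →
              inj₂ (T , t₀ , ℕ.m⊔n≤o⇒m≤o _ _ d₀⊔d₁ , t₁ , ℕ.m⊔n≤o⇒n≤o _ _ d₀⊔d₁ , p) })
       ((P? (leaf false) ⊎-dec P? (leaf true)) ⊎-dec
        anySubset? λ T → anyTree? d λ t₀ → anyTree? d λ t₁ → P? (node T t₀ t₁))

computableInDepth? : (f : BoolFun n) → Decidable (ComputableInDepth f)
computableInDepth? f d =
  map′ (λ { (t , _ , c) → t , c }) (λ { (t , eq , c) → t , ℕ.≤-reflexive eq , eq , c })
    (anyTree? d λ t → (depth t ℕ.≟ d) ×-dec computes? t f)

weaken : ParityTree n → ParityTree (suc n)
weaken (leaf b)       = leaf b
weaken (node T t₀ t₁) = node (outside ∷ T) (weaken t₀) (weaken t₁)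

output-weaken : (t : ParityTree n) (b : Bool) (x : Vec Bool n) →
                output (weaken t) (b ∷ x) ≡ output t x
output-weaken (leaf _) b x = refl
output-weaken (node T t₀ t₁) b x with parity T x
... | true  = output-weaken t₁ b x
... | false = output-weaken t₀ b x

parity-⊥ : (x : Vec Bool n) → parity ⊥ x ≡ false
parity-⊥ []      = refl
parity-⊥ (_ ∷ x) = parity-⊥ x

fullTree : BoolFun n → ParityTree n
fullTree {zero}  f = leaf (f [])
fullTree {suc n} f =
  node ⁅ zero ⁆ (weaken (fullTree (f ∘ (false ∷_)))) (weaken (fullTree (f ∘ (true ∷_))))

fullTree-computes : (f : BoolFun n) → Computes (fullTree f) f
fullTree-computes f [] = refl
fullTree-computes f (false ∷ x) rewrite parity-⊥ x =
  trans (output-weaken (fullTree (f ∘ (false ∷_))) false x) (fullTree-computes (f ∘ (false ∷_)) x)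
fullTree-computes f (true ∷ x) rewrite parity-⊥ x =
  trans (output-weaken (fullTree (f ∘ (true ∷_))) true x) (fullTree-computes (f ∘ (true ∷_)) x)

minDepth : (f : BoolFun n) → Minimum (ComputableInDepth f)
minDepth f = minimum (computableInDepth? f) (depth (fullTree f))
  (fullTree f , refl , fullTree-computes f)

D⊕ : BoolFun n → ℕ
D⊕ f = Minimum.value (minDepth f)

IsCauchy : (ℕ → ℚ) → Set
IsCauchy u = ∀ ε → .{{Positive ε}} →
  ∃[ N ] ∀ i j → N ℕ.≤ i → N ℕ.≤ j → ∣ u i - u j ∣ ℚ.< ε

record ℝ : Set where
  field
    seq    : ℕ → ℚ
    cauchy : IsCauchy seq

open ℝ public

-- Distinct sequences may denote the same real number; _≤ᵣ_ compares the
-- limits, and x, y are equal as reals exactly when x ≤ᵣ y and y ≤ᵣ x.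
infix 4 _≤ᵣ_

_≤ᵣ_ : ℝ → ℝ → Set
x ≤ᵣ y = ∀ ε → .{{Positive ε}} →
  ∃[ N ] ∀ i → N ℕ.≤ i → seq x i ℚ.< seq y i ℚ.+ ε

fromℚ : ℚ → ℝ
fromℚ q = record
  { seq    = λ _ → q
  ; cauchy = λ ε → 0 , λ _ _ _ _ →
      subst (ℚ._< ε) (sym (cong ∣_∣ (ℚ.+-inverseʳ q))) (ℚ.positive⁻¹ ε)
  }

fromℕ : ℕ → ℝ
fromℕ m = fromℚ (+ m / 1)

½*-positive : ∀ ε → .{{Positive ε}} → Positive (½ ℚ.* ε)
½*-positive ε = ℚ.pos*pos⇒pos ½ ε

½*ε+½*ε≡ε : ∀ ε → ½ ℚ.* ε ℚ.+ ½ ℚ.* ε ≡ ε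
½*ε+½*ε≡ε ε = trans (sym (ℚ.*-distribʳ-+ ε ½ ½)) (ℚ.*-identityˡ ε)

+-cauchy : ∀ u v → IsCauchy u → IsCauchy v → IsCauchy (λ i → u i ℚ.+ v i)
+-cauchy u v cu cv ε =
  let instance _ = ½*-positive ε
      (M , p) = cu (½ ℚ.* ε)
      (N , q) = cv (½ ℚ.* ε)
  in M ⊔ N , λ i j M⊔N≤i M⊔N≤j → begin-strict
    ∣ (u i ℚ.+ v i) - (u j ℚ.+ v j) ∣    ≡⟨ cong ∣_∣ (rearrange (u i) (v i) (u j) (v j)) ⟩
    ∣ (u i - u j) ℚ.+ (v i - v j) ∣      ≤⟨ ℚ.∣p+q∣≤∣p∣+∣q∣ (u i - u j) (v i - v j) ⟩
    ∣ u i - u j ∣ ℚ.+ ∣ v i - v j ∣      <⟨ ℚ.+-mono-<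
                                              (p i j (ℕ.m⊔n≤o⇒m≤o M N M⊔N≤i) (ℕ.m⊔n≤o⇒m≤o M N M⊔N≤j))
                                              (q i j (ℕ.m⊔n≤o⇒n≤o M N M⊔N≤i) (ℕ.m⊔n≤o⇒n≤o M N M⊔N≤j)) ⟩
    ½ ℚ.* ε ℚ.+ ½ ℚ.* ε                  ≡⟨ ½*ε+½*ε≡ε ε ⟩
    ε                                    ∎
  where
  open ℚ.≤-Reasoning
  rearrange : ∀ a b c d → (a ℚ.+ b) - (c ℚ.+ d) ≡ (a - c) ℚ.+ (b - d)
  rearrange = solve 4 (λ a b c d → (a :+ b) :- (c :+ d) := (a :- c) :+ (b :- d)) refl
    where open +-*-Solver

eventuallyBounded : ∀ {u} → IsCauchy u →
  ∃[ B ] Positive B × ∃[ N ] ∀ i → N ℕ.≤ i → ∣ u i ∣ ℚ.≤ B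
eventuallyBounded {u} cu =
  let (N , p) = cu 1ℚ
  in 1ℚ ℚ.+ ∣ u N ∣
   , ℚ.pos+nonNeg⇒pos 1ℚ ∣ u N ∣ {{ℚ.∣-∣-nonNeg (u N)}}
   , N
   , λ i N≤i → begin
       ∣ u i ∣                       ≡⟨ cong ∣_∣ (rearrange (u i) (u N)) ⟩
       ∣ (u i - u N) ℚ.+ u N ∣       ≤⟨ ℚ.∣p+q∣≤∣p∣+∣q∣ (u i - u N) (u N) ⟩
       ∣ u i - u N ∣ ℚ.+ ∣ u N ∣     ≤⟨ ℚ.+-monoˡ-≤ ∣ u N ∣ (ℚ.<⇒≤ (p i N N≤i ℕ.≤-refl)) ⟩
       1ℚ ℚ.+ ∣ u N ∣                ∎
  where
  open ℚ.≤-Reasoning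
  rearrange : ∀ a b → a ≡ (a - b) ℚ.+ b
  rearrange = solve 2 (λ a b → a := (a :- b) :+ b) refl
    where open +-*-Solver

boundedFactor : ∀ B ε → .{{Positive B}} → .{{Positive ε}} →
  ∃[ δ ] Positive δ × (∀ p q → ∣ p ∣ ℚ.≤ B → ∣ q ∣ ℚ.< δ → ∣ p ℚ.* q ∣ ℚ.< ε)
boundedFactor B ε = B⁻¹ ℚ.* ε , ℚ.pos*pos⇒pos B⁻¹ {{ℚ.1/pos⇒pos B}} ε , λ p q p≤B q<δ → begin-strict
  ∣ p ℚ.* q ∣              ≡⟨ ℚ.∣p*q∣≡∣p∣*∣q∣ p q ⟩
  ∣ p ∣ ℚ.* ∣ q ∣          ≤⟨ ℚ.*-monoʳ-≤-nonNeg ∣ q ∣ {{ℚ.∣-∣-nonNeg q}} p≤B ⟩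
  B ℚ.* ∣ q ∣              <⟨ ℚ.*-monoʳ-<-pos B q<δ ⟩
  B ℚ.* (B⁻¹ ℚ.* ε)        ≡⟨ ℚ.*-assoc B B⁻¹ ε ⟨
  (B ℚ.* B⁻¹) ℚ.* ε        ≡⟨ cong (ℚ._* ε) (ℚ.*-inverseʳ B {{B≢0}}) ⟩
  1ℚ ℚ.* ε                 ≡⟨ ℚ.*-identityˡ ε ⟩
  ε                        ∎
  where
  open ℚ.≤-Reasoning
  B≢0 = ℚ.pos⇒nonZero B
  B⁻¹ = (1/ B) {{B≢0}}

*-cauchy : ∀ u v → IsCauchy u → IsCauchy v → IsCauchy (λ i → u i ℚ.* v i)
*-cauchy u v cu cv ε =
  let B , B>0 , K , u≤B = eventuallyBounded cu
      C , C>0 , L , v≤C = eventuallyBounded cv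
      δ , δ>0 , small-v = boundedFactor B (½ ℚ.* ε) {{B>0}} {{½*-positive ε}}
      γ , γ>0 , small-u = boundedFactor C (½ ℚ.* ε) {{C>0}} {{½*-positive ε}}
      M , p = cu γ {{γ>0}}
      N , q = cv δ {{δ>0}}
  in (K ⊔ M) ⊔ (L ⊔ N) , λ i j ≤i ≤j →
    let iK = ℕ.m⊔n≤o⇒m≤o (K ⊔ M) (L ⊔ N) ≤i
        iL = ℕ.m⊔n≤o⇒n≤o (K ⊔ M) (L ⊔ N) ≤i
        jK = ℕ.m⊔n≤o⇒m≤o (K ⊔ M) (L ⊔ N) ≤j
        jL = ℕ.m⊔n≤o⇒n≤o (K ⊔ M) (L ⊔ N) ≤j
    in begin-strict
    ∣ u i ℚ.* v i - u j ℚ.* v j ∣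
      ≡⟨ cong ∣_∣ (rearrange (u i) (v i) (u j) (v j)) ⟩
    ∣ u i ℚ.* (v i - v j) ℚ.+ v j ℚ.* (u i - u j) ∣
      ≤⟨ ℚ.∣p+q∣≤∣p∣+∣q∣ (u i ℚ.* (v i - v j)) (v j ℚ.* (u i - u j)) ⟩
    ∣ u i ℚ.* (v i - v j) ∣ ℚ.+ ∣ v j ℚ.* (u i - u j) ∣
      <⟨ ℚ.+-mono-<
           (small-v (u i) (v i - v j) (u≤B i (ℕ.m⊔n≤o⇒m≤o K M iK))
             (q i j (ℕ.m⊔n≤o⇒n≤o L N iL) (ℕ.m⊔n≤o⇒n≤o L N jL)))
           (small-u (v j) (u i - u j) (v≤C j (ℕ.m⊔n≤o⇒m≤o L N jL))
             (p i j (ℕ.m⊔n≤o⇒n≤o K M iK) (ℕ.m⊔n≤o⇒n≤o K M jK))) ⟩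
    ½ ℚ.* ε ℚ.+ ½ ℚ.* ε
      ≡⟨ ½*ε+½*ε≡ε ε ⟩
    ε ∎
  where
  open ℚ.≤-Reasoning
  rearrange : ∀ a b c d → a ℚ.* b - c ℚ.* d ≡ a ℚ.* (b - d) ℚ.+ d ℚ.* (a - c)
  rearrange = solve 4 (λ a b c d → a :* b :- c :* d := a :* (b :- d) :+ d :* (a :- c)) refl
    where open +-*-Solver

infixl 6 _+ᵣ_
infixl 7 _*ᵣ_

_+ᵣ_ : ℝ → ℝ → ℝ
x +ᵣ y = record
  { seq    = λ i → seq x i ℚ.+ seq y i
  ; cauchy = +-cauchy (seq x) (seq y) (cauchy x) (cauchy y)
  }

_*ᵣ_ : ℝ → ℝ → ℝ
x *ᵣ y = record
  { seq    = λ i → seq x i ℚ.* seq y i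
  ; cauchy = *-cauchy (seq x) (seq y) (cauchy x) (cauchy y)
  }

-- Coefficients in order of increasing degree.
Polynomial : Set
Polynomial = List ℝ

⟦_⟧ : Polynomial → ℝ → ℝ
⟦ []     ⟧ x = fromℚ 0ℚ
⟦ c ∷ cs ⟧ x = c +ᵣ x *ᵣ ⟦ cs ⟧ x

{-# OPTIONS --safe #-}
module Submission where

open import Defs
open import Algebra.Bundles using (CommutativeRing)
import Algebra.Properties.CommutativeSemigroup as CommutativeSemigroupProperties
open import Data.Bool.Base using (Bool; true; false; if_then_else_; _xor_; _∧_)
import Data.Bool.Properties as Bool
open import Data.Fin.Base using (Fin; zero; suc; _↑ˡ_; _↑ʳ_)
open import Data.Fin.Properties using (any?; _≟_)
open import Data.Fin.Subset using (Subset; ⁅_⁆; ⊥; ∁; _∩_; _∈_; _∉_; _⊆_; _-_; ∣_∣)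
open import Data.Fin.Subset.Properties
  using ( _∈?_; anySubset?; ⊥⊆; ⊆-refl; ⊆-antisym; x∈p∩q⁺; x∈p∩q⁻; p∩q⊆p; p─q⊆p; p─⊥≡p
        ; x∈p⇒∣p-x∣<∣p∣; x∉p⇒x∈∁p; x≢y⇒x∉⁅y⁆; ∩-comm; ∩-idem; ∩-zeroˡ; ∩-zeroʳ; ∩-inverseʳ)
open import Data.Integer.Base as ℤ using (+_)
import Data.Integer.Properties as ℤ
open import Data.List.Base as List using (List; []; _∷_; _++_; length; filter; allFin; map)
import Data.List.Membership.DecPropositional as DecMembership
open import Data.List.Membership.Propositional using (lose) renaming (_∈_ to _∈ᴸ_; _∉_ to _∉ᴸ_)
open import Data.List.Membership.Propositional.Properties
  using (∈-++⁺ˡ; ∈-++⁺ʳ; ∈-filter⁺; ∈-allFin)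
open import Data.List.Properties
  using (length-++; length-filter; filter-++; ∷-injectiveˡ; ∷-injectiveʳ; ≡-dec)
open import Data.List.Relation.Unary.Any as Any using (Any; here; there)
open import Data.Nat.Base as ℕ using (ℕ; zero; suc; _+_; _*_; _⊔_; _≤_; _<_; z≤n; s≤s)
open import Data.Nat.Coprimality as Coprimality using (1-coprimeTo)
open import Data.Nat.Induction using (Acc; acc; <-wellFounded)
import Data.Nat.Properties as ℕ
open import Data.Nat.Tactic.RingSolver using (solve-∀)
open import Data.Product.Base using (Σ-syntax; ∃-syntax; ∃₂; _×_; _,_; proj₁; proj₂)
open import Data.Rational.Base as ℚ using (ℚ; 0ℚ; 1ℚ; _/_; mkℚ)
open import Data.Rational.Literals using (fromℤ)
import Data.Rational.Properties as ℚ
open import Data.Sum.Base as Sum using (_⊎_; inj₁; inj₂)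
open import Data.Unit.Base using (tt)
open import Data.Vec.Base as Vec using (Vec; []; _∷_; lookup; tabulate; take; drop) renaming (_++_ to _++ᵛ_)
open import Data.Vec.Properties as Vec
  using ( lookup∘tabulate; lookup-zipWith; []=⇒lookup; zipWith-assoc; zipWith-distribʳ; zipWith-++
        ; ++-injectiveˡ; ++-injectiveʳ; take++drop≡id)
open import Data.Vec.Relation.Unary.All as All using (All; []; _∷_)
import Data.Vec.Relation.Unary.All.Properties as All
open import Data.Vec.Relation.Unary.AllPairs as AllPairs using (AllPairs; []; _∷_)
import Data.Vec.Relation.Unary.AllPairs.Properties as AllPairs
open import Function.Base using (_∘_; id)
open import Function.Bundles using (_⇔_; mk⇔)
open import Relation.Binary.PropositionalEquality
  using (_≡_; _≢_; refl; sym; trans; cong; cong₂; subst; module ≡-Reasoning)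
open import Relation.Nullary.Decidable using (Dec; yes; no; _×-dec_; decidable-stable)
open import Relation.Nullary.Negation using (¬_; contradiction)
open import Relation.Unary using (Decidable)

open CommutativeSemigroupProperties
  (CommutativeRing.+-commutativeSemigroup Bool.xor-∧-commutativeRing) using (interchange)

-- (1) ⇒ (2). Minimal sensitive blocks at x have at most s(f) elements, so the
-- union of a maximum disjoint family of them is a certificate of size
-- c = bs(f) s(f). A certificate of a 0-input and one of a 1-input share a
-- variable on which the two inputs differ; hence querying a whole 1-certificate
-- consumes a new variable of every 0-certificate, and D⊕(f) ≤ D(f) ≤ c².
--
-- (2) ⇒ (1). Fix x attaining bs(f) and put h(a, b) = f(x ⊕ (a ∧ b)), so that
-- s(h) ≤ 2 s(f). Run a parity decision tree for h on an affine family of inputs: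
-- a parity that is not constant on the family depends on some aᵢ or bᵢ; setting
-- the other bit of that pair to 0 and solving for this one fixes the answer, at
-- the cost of fixing only the i-th bit of a ∧ b to 0. With fewer queries than
-- disjoint sensitive blocks, some block B survives untouched, and the tree
-- cannot tell a ∧ b = ∅ from a ∧ b = e_B. Hence bs(f) ≤ D⊕(h).

-- Natural-number majorants of real polynomials

ι : ℕ → ℚ
ι m = + m / 1

-- `_/_` normalises by a gcd and is stuck on a variable; `fromℤ` exposes the numerator and the
-- denominator 1, which reduces the laws below to integer ones.
ι≡fromℤ : ∀ m → ι m ≡ fromℤ (+ m)
ι≡fromℤ m = ℚ.normalize-coprime (Coprimality.sym (1-coprimeTo m))

ι-+ : ∀ a b → ι (a + b) ≡ ι a ℚ.+ ι b
ι-+ a b rewrite ι≡fromℤ a | ι≡fromℤ b =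
  cong (_/ 1) (sym (cong₂ ℤ._+_ (ℤ.*-identityʳ (+ a)) (ℤ.*-identityʳ (+ b))))

ι-* : ∀ a b → ι (a * b) ≡ ι a ℚ.* ι b
ι-* a b rewrite ι≡fromℤ a | ι≡fromℤ b = cong (_/ 1) (ℤ.pos-* a b)

ι-mono-≤ : ∀ {a b} → a ≤ b → ι a ℚ.≤ ι b
ι-mono-≤ {a} {b} a≤b rewrite ι≡fromℤ a | ι≡fromℤ b =
  ℚ.*≤* (ℤ.*-monoʳ-≤-nonNeg (+ 1) (ℤ.+≤+ a≤b))

ι-cancel-< : ∀ {a b} → ι a ℚ.< ι b → a < b
ι-cancel-< {a} {b} a<b = ℕ.≰⇒> λ b≤a → ℚ.<-irrefl refl (ℚ.<-≤-trans a<b (ι-mono-≤ b≤a))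

q≤ι : ∀ q → ∃[ k ] q ℚ.≤ ι k
q≤ι q@(mkℚ n d-1 _) = k , subst (q ℚ.≤_) (sym (ι≡fromℤ k)) (ℚ.*≤* (begin
  n ℤ.* + 1              ≡⟨ ℤ.*-identityʳ n ⟩
  n                      ≤⟨ i≤∣i∣ n ⟩
  + k                    ≤⟨ ℤ.+≤+ (ℕ.m≤m*n k (suc d-1)) ⟩
  + (k * suc d-1)      ≡⟨ ℤ.pos-* k (suc d-1) ⟩
  + k ℤ.* + suc d-1      ∎))
  where
  open ℤ.≤-Reasoning
  -- The denominator is at least 1, so the absolute value of the numerator already dominates `q`.
  k = ℤ.∣ n ∣
  i≤∣i∣ : ∀ i → i ℤ.≤ + ℤ.∣ i ∣
  i≤∣i∣ (+ _)       = ℤ.≤-refl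
  i≤∣i∣ (ℤ.-[1+ _ ]) = ℤ.-≤+

eval : List ℕ → ℕ → ℕ
eval []       m = 0
eval (c ∷ cs) m = c + m * eval cs m

eval-mono : ∀ cs {m m′} → m ≤ m′ → eval cs m ≤ eval cs m′
eval-mono []       m≤m′ = z≤n
eval-mono (c ∷ cs) m≤m′ = ℕ.+-monoʳ-≤ c (ℕ.*-mono-≤ m≤m′ (eval-mono cs m≤m′))

infixl 6 _+ᴾ_
infixl 7 _*ᴾ_

_+ᴾ_ : List ℕ → List ℕ → List ℕ
[]       +ᴾ ds       = ds
(c ∷ cs) +ᴾ []       = c ∷ cs
(c ∷ cs) +ᴾ (d ∷ ds) = c + d ∷ cs +ᴾ ds

_*ᴾ_ : List ℕ → List ℕ → List ℕ
[]       *ᴾ ds = []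
(c ∷ cs) *ᴾ ds = map (c *_) ds +ᴾ (0 ∷ cs *ᴾ ds)

_∘ᴾ_ : List ℕ → List ℕ → List ℕ
[]       ∘ᴾ ds = []
(c ∷ cs) ∘ᴾ ds = (c ∷ []) +ᴾ ds *ᴾ (cs ∘ᴾ ds)

eval-+ : ∀ cs ds m → eval (cs +ᴾ ds) m ≡ eval cs m + eval ds m
eval-+ []       ds       m = refl
eval-+ (c ∷ cs) []       m = sym (ℕ.+-identityʳ _)
eval-+ (c ∷ cs) (d ∷ ds) m rewrite eval-+ cs ds m = lemma c d m (eval cs m) (eval ds m)
  where
  lemma : ∀ c d m x y → c + d + m * (x + y) ≡ c + m * x + (d + m * y)
  lemma = solve-∀

eval-map : ∀ k cs m → eval (map (k *_) cs) m ≡ k * eval cs m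
eval-map k []       m = sym (ℕ.*-zeroʳ k)
eval-map k (c ∷ cs) m rewrite eval-map k cs m = lemma k c m (eval cs m)
  where
  lemma : ∀ k c m x → k * c + m * (k * x) ≡ k * (c + m * x)
  lemma = solve-∀

eval-* : ∀ cs ds m → eval (cs *ᴾ ds) m ≡ eval cs m * eval ds m
eval-* []       ds m = refl
eval-* (c ∷ cs) ds m
  rewrite eval-+ (map (c *_) ds) (0 ∷ cs *ᴾ ds) m | eval-map c ds m | eval-* cs ds m =
  lemma c m (eval cs m) (eval ds m)
  where
  lemma : ∀ c m x y → c * y + m * (x * y) ≡ (c + m * x) * y
  lemma = solve-∀

eval-∘ : ∀ cs ds m → eval (cs ∘ᴾ ds) m ≡ eval cs (eval ds m)
eval-∘ []       ds m = refl
eval-∘ (c ∷ cs) ds m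
  rewrite eval-+ (c ∷ []) (ds *ᴾ (cs ∘ᴾ ds)) m | eval-* ds (cs ∘ᴾ ds) m | eval-∘ cs ds m
        | ℕ.*-zeroʳ m | ℕ.+-identityʳ c = refl

seq-⟦map-fromℕ⟧ : ∀ cs m i → seq (⟦ map fromℕ cs ⟧ (fromℕ m)) i ≡ ι (eval cs m)
seq-⟦map-fromℕ⟧ []       m i = refl
seq-⟦map-fromℕ⟧ (c ∷ cs) m i
  rewrite seq-⟦map-fromℕ⟧ cs m i | ι-+ c (m * eval cs m) | ι-* m (eval cs m) = refl

≤⇒≤ᵣ : ∀ cs {a m} → a ≤ eval cs m → fromℕ a ≤ᵣ ⟦ map fromℕ cs ⟧ (fromℕ m)
≤⇒≤ᵣ cs {a} {m} a≤ ε = 0 , λ i _ → begin-strict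
  ι a                                          ≤⟨ ι-mono-≤ a≤ ⟩
  ι (eval cs m)                                ≡⟨ seq-⟦map-fromℕ⟧ cs m i ⟨
  y i                                          ≡⟨ ℚ.+-identityʳ (y i) ⟨
  y i ℚ.+ 0ℚ                                   <⟨ ℚ.+-monoʳ-< (y i) (ℚ.positive⁻¹ ε) ⟩
  y i ℚ.+ ε                                    ∎
  where
  open ℚ.≤-Reasoning
  y = seq (⟦ map fromℕ cs ⟧ (fromℕ m))

eventually≤ι : ∀ c → ∃[ k ] ∃[ N ] ∀ i → N ≤ i → seq c i ℚ.≤ ι k
eventually≤ι c =
  let B , _ , N , ∣c∣≤B = eventuallyBounded (cauchy c)
      k , B≤k = q≤ι B
  in k , N , λ i N≤i → ℚ.≤-trans (p≤∣p∣ (seq c i)) (ℚ.≤-trans (∣c∣≤B i N≤i) B≤k)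
  where
  p≤∣p∣ : ∀ p → p ℚ.≤ ℚ.∣ p ∣
  p≤∣p∣ p@(mkℚ (+ _) _ _)      = ℚ.≤-refl
  p≤∣p∣ p@(mkℚ ℤ.-[1+ _ ] _ _) = ℚ.<⇒≤ (ℚ.neg<pos p ℚ.∣ p ∣)

-- A real polynomial may have negative coefficients and so fail to be monotone. Rounding each
-- coefficient up to a natural number dominates it at natural arguments, and the result is monotone,
-- which matters once `s` is itself only bounded from above.
majorant : Polynomial → List ℕ
majorant = map (proj₁ ∘ eventually≤ι)

eventually-≤-majorant : ∀ p m → ∃[ N ] ∀ i → N ≤ i →
  seq (⟦ p ⟧ (fromℕ m)) i ℚ.≤ ι (eval (majorant p) m)
eventually-≤-majorant []      m = 0 , λ _ _ → ℚ.≤-refl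
eventually-≤-majorant (c ∷ p) m =
  let k , M , c≤k = eventually≤ι c
      N , p≤e = eventually-≤-majorant p m
      e = eval (majorant p) m
  in M ⊔ N , λ i M⊔N≤i → begin
    seq c i ℚ.+ ι m ℚ.* seq (⟦ p ⟧ (fromℕ m)) i
      ≤⟨ ℚ.+-mono-≤ (c≤k i (ℕ.m⊔n≤o⇒m≤o M N M⊔N≤i))
           (ℚ.*-monoˡ-≤-nonNeg (ι m) {{ℚ.normalize-nonNeg m 1}} (p≤e i (ℕ.m⊔n≤o⇒n≤o M N M⊔N≤i))) ⟩
    ι k ℚ.+ ι m ℚ.* ι e      ≡⟨ cong (ι k ℚ.+_) (ι-* m e) ⟨
    ι k ℚ.+ ι (m * e)      ≡⟨ ι-+ k (m * e) ⟨
    ι (k + m * e)        ∎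
  where open ℚ.≤-Reasoning

-- Tolerance 1 in `_≤ᵣ_` is enough: a natural number strictly below `e + 1` is at most `e`.
≤ᵣ⇒≤ : ∀ p {a m} → fromℕ a ≤ᵣ ⟦ p ⟧ (fromℕ m) → a ≤ eval (majorant p) m
≤ᵣ⇒≤ p {a} {m} a≤p =
  let M , a<p+1 = a≤p 1ℚ
      N , p≤e = eventually-≤-majorant p m
  in ℕ.s≤s⁻¹ (ι-cancel-< (begin-strict
    ι a                                            <⟨ a<p+1 (M ⊔ N) (ℕ.m≤m⊔n M N) ⟩
    seq (⟦ p ⟧ (fromℕ m)) (M ⊔ N) ℚ.+ 1ℚ           ≤⟨ ℚ.+-monoˡ-≤ 1ℚ (p≤e (M ⊔ N) (ℕ.m≤n⊔m M N)) ⟩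
    ι e ℚ.+ ι 1                                    ≡⟨ ι-+ e 1 ⟨
    ι (e + 1)                                    ≡⟨ cong ι (ℕ.+-comm e 1) ⟩
    ι (suc e)                                      ∎))
  where
  open ℚ.≤-Reasoning
  e = eval (majorant p) m

-- Maxima over the cube, lengths of filtered lists, and XOR

private
  variable
    n k N : ℕ

cubeMax-upper : (g : Vec Bool n → ℕ) → ∀ x → g x ≤ cubeMax g
cubeMax-upper g []          = ℕ.≤-refl
cubeMax-upper g (false ∷ x) = ℕ.≤-trans (cubeMax-upper (g ∘ (false ∷_)) x) (ℕ.m≤m⊔n _ _)
cubeMax-upper g (true  ∷ x) = ℕ.≤-trans (cubeMax-upper (g ∘ (true ∷_)) x) (ℕ.m≤n⊔m _ _)

cubeMax-lub : (g : Vec Bool n → ℕ) → ∀ {c} → (∀ x → g x ≤ c) → cubeMax g ≤ c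
cubeMax-lub {zero}  g g≤c = g≤c []
cubeMax-lub {suc n} g g≤c =
  ℕ.⊔-lub (cubeMax-lub (g ∘ (false ∷_)) (g≤c ∘ (false ∷_)))
          (cubeMax-lub (g ∘ (true ∷_)) (g≤c ∘ (true ∷_)))

module _ {A : Set} {P Q : A → Set} (P? : Decidable P) (Q? : Decidable Q)
         (P⊆Q : ∀ {x} → P x → Q x) where

  length-filter-mono : ∀ xs → length (filter P? xs) ≤ length (filter Q? xs)
  length-filter-mono [] = z≤n
  length-filter-mono (x ∷ xs) with P? x | Q? x
  ... | yes p | yes q = s≤s (length-filter-mono xs)
  ... | yes p | no ¬q = contradiction (P⊆Q p) ¬q
  ... | no ¬p | yes q = ℕ.m≤n⇒m≤1+n (length-filter-mono xs)
  ... | no ¬p | no ¬q = length-filter-mono xs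

  length-filter-mono-< : ∀ {xs} → Any (λ x → Q x × ¬ P x) xs →
                         length (filter P? xs) < length (filter Q? xs)
  length-filter-mono-< {x ∷ xs} (here (q , ¬p)) with P? x | Q? x
  ... | yes p | _     = contradiction p ¬p
  ... | no _  | yes _ = s≤s (length-filter-mono xs)
  ... | no _  | no ¬q = contradiction q ¬q
  length-filter-mono-< {x ∷ xs} (there any) with P? x | Q? x
  ... | yes p | yes q = s≤s (length-filter-mono-< any)
  ... | yes p | no ¬q = contradiction (P⊆Q p) ¬q
  ... | no ¬p | yes q = ℕ.m≤n⇒m≤1+n (length-filter-mono-< any)
  ... | no ¬p | no ¬q = length-filter-mono-< any

⊕-assoc : (x y z : Vec Bool n) → x ⊕ y ⊕ z ≡ x ⊕ (y ⊕ z)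
⊕-assoc = zipWith-assoc Bool.xor-assoc

x⊕x⊕y≡y : (x y : Vec Bool n) → x ⊕ (x ⊕ y) ≡ y
x⊕x⊕y≡y []      []      = refl
x⊕x⊕y≡y (a ∷ x) (b ∷ y) = cong₂ _∷_
  (trans (sym (Bool.xor-assoc a a b)) (cong (_xor b) (Bool.xor-same a))) (x⊕x⊕y≡y x y)

p⊕⁅i⁆≡p-i : ∀ {p : Subset n} {i} → i ∈ p → p ⊕ ⁅ i ⁆ ≡ p - i
p⊕⁅i⁆≡p-i {p = _ ∷ p} {zero}  Vec.here        = cong (false ∷_) (trans (⊕-identityʳ p) (sym (p─⊥≡p p)))
p⊕⁅i⁆≡p-i {p = b ∷ p} {suc i} (Vec.there i∈p) = cong₂ _∷_ (Bool.xor-identityʳ b) (p⊕⁅i⁆≡p-i i∈p)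

-- Certificates from block sensitivity

elements : Subset n → List (Fin n)
elements {n} B = filter (_∈? B) (allFin n)

module _ (f : BoolFun n) where

  Minimal : Vec Bool n → Subset n → Set
  Minimal x B = Sensitive f x B × ∀ {i} → i ∈ B → ¬ Sensitive f x (B - i)

  -- Elements whose removal leaves a sensitive block are removed one at a time. `C` is produced for
  -- every `B`, sensitive or not, so that the choice can be mapped over a family as a plain
  -- function.
  minimise : ∀ x B → ∃[ C ] C ⊆ B × (Sensitive f x B → Minimal x C)
  minimise x B = go B (<-wellFounded ∣ B ∣)
    where
    go : ∀ B → Acc _<_ ∣ B ∣ → ∃[ C ] C ⊆ B × (Sensitive f x B → Minimal x C)
    go B (acc rec) with any? (λ i → (i ∈? B) ×-dec sensitive? f x (B - i))
    ... | no none = B , (λ i∈B → i∈B) , λ sens → sens , λ i∈B sens′ → none (_ , i∈B , sens′)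
    ... | yes (i , i∈B , sens) =
      let C , C⊆B-i , min = go (B - i) (rec (x∈p⇒∣p-x∣<∣p∣ i∈B))
      in C , p─q⊆p B ⁅ i ⁆ ∘ C⊆B-i , λ _ → min sens

  -- At `x ⊕ B` every element of `B` is a sensitive coordinate: flipping it back gives
  -- `x ⊕ (B - i)`, where by minimality `f` has the value `f x`, unlike at `x ⊕ B`.
  minimal⇒length≤s : ∀ {x B} → Minimal x B → length (elements B) ≤ s f
  minimal⇒length≤s {x} {B} (sens , min) = ℕ.≤-trans
    (length-filter-mono (_∈? B) (λ i → sensitive? f (x ⊕ B) ⁅ i ⁆) flip (allFin n))
    (cubeMax-upper (sensitivityAt f) (x ⊕ B))
    where
    flip : ∀ {i} → i ∈ B → Sensitive f (x ⊕ B) ⁅ i ⁆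
    flip {i} i∈B eq = sens (begin
      f (x ⊕ B)            ≡⟨ eq ⟨
      f (x ⊕ B ⊕ ⁅ i ⁆)    ≡⟨ cong f (⊕-assoc x B ⁅ i ⁆) ⟩
      f (x ⊕ (B ⊕ ⁅ i ⁆))  ≡⟨ cong (f ∘ (x ⊕_)) (p⊕⁅i⁆≡p-i i∈B) ⟩
      f (x ⊕ (B - i))      ≡⟨ decidable-stable (f (x ⊕ (B - i)) Bool.≟ f x) (min i∈B) ⟩
      f x                  ∎)
      where open ≡-Reasoning

variables : Vec (Subset n) k → List (Fin n)
variables []       = []
variables (B ∷ Bs) = elements B ++ variables Bs

length-variables : ∀ {c} {Bs : Vec (Subset n) k} → All (λ B → length (elements B) ≤ c) Bs →
                   length (variables Bs) ≤ k * c
length-variables []                    = z≤n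
length-variables {Bs = B ∷ _} (p ∷ ps) =
  ℕ.≤-trans (ℕ.≤-reflexive (length-++ (elements B))) (ℕ.+-mono-≤ p (length-variables ps))

disjoint-from-variables : ∀ {B} (Bs : Vec (Subset n) k) →
  (∀ {i} → i ∈ B → i ∉ᴸ variables Bs) → All (Disjoint B) Bs
disjoint-from-variables         []       _   = []
disjoint-from-variables {B = B} (C ∷ Cs) B∉ =
  (λ { (i , i∈B∩C) → let i∈B , i∈C = x∈p∩q⁻ B C i∈B∩C in
       B∉ i∈B (∈-++⁺ˡ (∈-filter⁺ (_∈? C) (∈-allFin i) i∈C)) }) ∷
  disjoint-from-variables Cs (λ i∈B → B∉ i∈B ∘ ∈-++⁺ʳ (elements C))

AgreeOn : List (Fin n) → Vec Bool n → Vec Bool n → Set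
AgreeOn E x y = ∀ {i} → i ∈ᴸ E → lookup x i ≡ lookup y i

agreeOn-++ : ∀ {x y : Vec Bool n} L {R} → map (lookup x) L ≡ map (lookup y) L → AgreeOn R x y →
             AgreeOn (L ++ R) x y
agreeOn-++             []      _  x≈y i∈          = x≈y i∈
agreeOn-++             (_ ∷ L) eq x≈y (here refl) = ∷-injectiveˡ eq
agreeOn-++ {x = x} {y} (_ ∷ L) eq x≈y (there i∈)  =
  agreeOn-++ {x = x} {y} L (∷-injectiveʳ eq) x≈y i∈

Certificate : BoolFun n → Vec Bool n → List (Fin n) → Set
Certificate f x E = ∀ y → AgreeOn E x y → f x ≡ f y

-- The variables are those of a maximum disjoint family of sensitive blocks, each shrunk to a
-- minimal one. If `y` agrees with `x` on them but `f y` differs from `f x`, then `x ⊕ y` is one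
-- more sensitive block disjoint from the family, against maximality.
certificate : (f : BoolFun n) → ∀ x → ∃[ E ] length E ≤ bs f * s f × Certificate f x E
certificate {n} f x =
  let Bs , sens , dis = attained
      shrink : Subset n → Subset n
      shrink B = proj₁ (minimise f x B)
      shrink⊆ : ∀ B → shrink B ⊆ B
      shrink⊆ B = proj₁ (proj₂ (minimise f x B))
      Cs = Vec.map shrink Bs
      min : All (Minimal f x) Cs
      min = All.map⁺ (All.map (λ {B} → proj₂ (proj₂ (minimise f x B))) sens)
      dis′ : AllPairs Disjoint Cs
      dis′ = AllPairs.map⁺ (AllPairs.map (λ {B} {C} → disjoint-mono (shrink⊆ B) (shrink⊆ C)) dis)
  in variables Cs
   , ℕ.≤-trans (length-variables (All.map (minimal⇒length≤s f) min))
       (ℕ.*-monoˡ-≤ (s f) (cubeMax-upper (blockSensitivityAt f) x))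
   , λ y agree → sym (decidable-stable (f y Bool.≟ f x) λ fy≢fx →
       ℕ.1+n≰n (bound
         ( x ⊕ y ∷ Cs
         , (fy≢fx ∘ trans (cong f (sym (x⊕x⊕y≡y x y)))) ∷ All.map proj₁ min
         , disjoint-from-variables Cs (λ i∈x⊕y → differ y i∈x⊕y ∘ agree) ∷ dis′)))
  where
  open Maximum (maxSensitiveFamily f x)

  disjoint-mono : ∀ {B B′ C C′ : Subset n} → B′ ⊆ B → C′ ⊆ C → Disjoint B C → Disjoint B′ C′
  disjoint-mono {B′ = B′} {C′ = C′} B′⊆B C′⊆C dis (i , i∈B′∩C′) =
    let i∈B′ , i∈C′ = x∈p∩q⁻ B′ C′ i∈B′∩C′ in dis (i , x∈p∩q⁺ (B′⊆B i∈B′ , C′⊆C i∈C′))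

  differ : ∀ y {i} → i ∈ x ⊕ y → lookup x i ≢ lookup y i
  differ y {i} i∈x⊕y xᵢ≡yᵢ = contradiction (begin
    true                       ≡⟨ []=⇒lookup i∈x⊕y ⟨
    lookup (x ⊕ y) i           ≡⟨ lookup-zipWith _xor_ i x y ⟩
    lookup x i xor lookup y i  ≡⟨ cong (_xor lookup y i) xᵢ≡yᵢ ⟩
    lookup y i xor lookup y i  ≡⟨ Bool.xor-same (lookup y i) ⟩
    false                      ∎) λ ()
    where open ≡-Reasoning

-- Decision trees from certificates

parity-⁅⁆ : ∀ i (x : Vec Bool n) → parity ⁅ i ⁆ x ≡ lookup x i
parity-⁅⁆ zero    (b ∷ x) = trans (cong (b xor_) (parity-⊥ x)) (Bool.xor-identityʳ b)
parity-⁅⁆ (suc i) (_ ∷ x) = parity-⁅⁆ i x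

module _ (f : BoolFun n) where

  SolvableOn : (Vec Bool n → Set) → ℕ → Set
  SolvableOn A d = ∃[ t ] depth t ≤ d × (∀ {y} → A y → output t y ≡ f y)

  restrict : ∀ {A A′ d} → (∀ {y} → A′ y → A y) → SolvableOn A d → SolvableOn A′ d
  restrict A′⊆A (t , t≤d , correct) = t , t≤d , correct ∘ A′⊆A

  query : ∀ {A d} i → (∀ b → SolvableOn (λ y → A y × lookup y i ≡ b) d) → SolvableOn A (suc d)
  query {A} i solve with solve false | solve true
  ... | t₀ , t₀≤d , correct₀ | t₁ , t₁≤d , correct₁ =
    node ⁅ i ⁆ t₀ t₁ , s≤s (ℕ.⊔-lub t₀≤d t₁≤d) , correct
    where
    correct : ∀ {y} → A y → output (node ⁅ i ⁆ t₀ t₁) y ≡ f y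
    correct {y} Ay rewrite parity-⁅⁆ i y with lookup y i in yᵢ≡b
    ... | false = correct₀ (Ay , yᵢ≡b)
    ... | true  = correct₁ (Ay , yᵢ≡b)

  queryAll : ∀ L {A d} → (∀ v → SolvableOn (λ y → A y × map (lookup y) L ≡ v) d) →
             SolvableOn A (length L + d)
  queryAll []      solve = restrict (_, refl) (solve [])
  queryAll (i ∷ L) solve = query i λ b → queryAll L λ v →
    restrict (λ { ((Ay , yᵢ≡b) , y≡v) → Ay , cong₂ _∷_ yᵢ≡b y≡v }) (solve (b ∷ v))

module _ {n} (f : BoolFun n) {c} (cert : ∀ x → ∃[ E ] length E ≤ c × Certificate f x E) where

  open DecMembership (_≟_ {n}) using () renaming (_∈?_ to _∈ᴸ?_; _∉?_ to _∉ᴸ?_)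

  E : Vec Bool n → List (Fin n)
  E x = proj₁ (cert x)

  -- Otherwise let `m` equal `x` on `E x` and `y` elsewhere. It agrees with `y` on `E y` too, since
  -- a variable common to both certificates would lie in `R`, where `x` and `y` agree. Both
  -- certificates then apply to `m`, giving `f x ≡ f m ≡ f y`.
  certificates-meet : ∀ R {x y} → AgreeOn R x y → f x ≢ f y → Any (λ i → i ∉ᴸ R × i ∈ᴸ E x) (E y)
  certificates-meet R {x} {y} x≈y fx≢fy =
    decidable-stable (Any.any? (λ i → (i ∉ᴸ? R) ×-dec (i ∈ᴸ? E x)) (E y)) λ none →
      fx≢fy (trans (proj₂ (proj₂ (cert x)) m x≈m) (sym (proj₂ (proj₂ (cert y)) m (y≈m none))))
    where
    select : ∀ i → Dec (i ∈ᴸ E x) → Bool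
    select i (yes _) = lookup x i
    select i (no _)  = lookup y i
    m : Vec Bool n
    m = tabulate λ i → select i (i ∈ᴸ? E x)
    x≈m : AgreeOn (E x) x m
    x≈m {i} i∈Ex rewrite lookup∘tabulate (λ i → select i (i ∈ᴸ? E x)) i with i ∈ᴸ? E x
    ... | yes _ = refl
    ... | no i∉ = contradiction i∈Ex i∉
    y≈m : ¬ Any (λ i → i ∉ᴸ R × i ∈ᴸ E x) (E y) → AgreeOn (E y) y m
    y≈m none {i} i∈Ey rewrite lookup∘tabulate (λ i → select i (i ∈ᴸ? E x)) i with i ∈ᴸ? E x
    ... | no _ = refl
    ... | yes i∈Ex with i ∈ᴸ? R
    ...   | yes i∈R = sym (x≈y i∈R)
    ...   | no i∉R  = contradiction (lose i∈Ey (i∉R , i∈Ex)) none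

  unqueried : List (Fin n) → Vec Bool n → ℕ
  unqueried R y = length (filter (_∉ᴸ? R) (E y))

  -- `A` is the set of inputs consistent with the answers so far, and `k` bounds the rounds left. A
  -- round queries the whole certificate of some 1-input in `A`; by `certificates-meet` this uses up
  -- a new certificate variable of every 0-input in `A`. If `A` has no 1-input, the answer is known.
  solve : ∀ k R {A : Vec Bool n → Set} → Decidable A →
          (∀ {x y} → A x → A y → AgreeOn R x y) →
          (∀ {y} → A y → f y ≡ false → unqueried R y ≤ k) →
          SolvableOn f A (k * c)
  solve k R {A} A? agree unqueried≤k with anySubset? (λ x → A? x ×-dec (f x Bool.≟ true))
  ... | no none = leaf false , z≤n , λ {y} Ay → sym (Bool.¬-not (λ fy → none (y , Ay , fy)))
  ... | yes (x , Ax , fx) = continue k unqueried≤k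
    where
    shrinks : ∀ {y} → A y → f y ≡ false → unqueried (E x ++ R) y < unqueried R y
    shrinks {y} Ay fy = length-filter-mono-< (_∉ᴸ? (E x ++ R)) (_∉ᴸ? R) (_∘ ∈-++⁺ʳ (E x))
      (Any.map (λ { (i∉R , i∈Ex) → i∉R , λ i∉ → i∉ (∈-++⁺ˡ i∈Ex) })
        (certificates-meet R (agree Ax Ay) λ fx≡fy →
          contradiction (trans (sym fx) (trans fx≡fy fy)) λ ()))

    continue : ∀ k → (∀ {y} → A y → f y ≡ false → unqueried R y ≤ k) → SolvableOn f A (k * c)
    -- A 0-input in `A` would share an unqueried variable with `E x`, but none is left to it; so `f`
    -- is true on all of `A`.
    continue zero unqueried≤0 = leaf true , z≤n , λ Ay → sym (Bool.¬-not λ fy →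
      contradiction (ℕ.<-≤-trans (shrinks Ay fy) (unqueried≤0 Ay fy)) ℕ.n≮0)
    continue (suc k) unqueried≤1+k =
      let t , t≤ , correct = queryAll f (E x) λ v → solve k (E x ++ R)
            (λ y → A? y ×-dec ≡-dec Bool._≟_ (map (lookup y) (E x)) v)
            (λ { {y} {z} (Ay , y≡v) (Az , z≡v) →
                 agreeOn-++ {x = y} {z} (E x) (trans y≡v (sym z≡v)) (agree Ay Az) })
            (λ { (Ay , _) fy → ℕ.s≤s⁻¹ (ℕ.<-≤-trans (shrinks Ay fy) (unqueried≤1+k Ay fy)) })
      in t , ℕ.≤-trans t≤ (ℕ.+-monoˡ-≤ (k * c) (proj₁ (proj₂ (cert x)))) , correct

  D⊕≤c*c : D⊕ f ≤ c * c
  D⊕≤c*c =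
    -- Before any query the unqueried count is at most the certificate size, hence `c` rounds of at
    -- most `c` queries.
    let t , t≤ , correct = solve c [] (λ _ → yes tt) (λ _ _ ())
          (λ {y} _ _ → ℕ.≤-trans (length-filter (_∉ᴸ? []) (E y)) (proj₁ (proj₂ (cert y))))
    in ℕ.≤-trans (Minimum.bound (minDepth f) (t , refl , λ x → correct {x} tt)) t≤

D⊕≤[bs*s]² : (f : BoolFun n) → D⊕ f ≤ (bs f * s f) * (bs f * s f)
D⊕≤[bs*s]² f = D⊕≤c*c f (certificate f)

-- Parity queries on affine families of inputs

⊕-interchange : (a b c d : Vec Bool n) → (a ⊕ b) ⊕ (c ⊕ d) ≡ (a ⊕ c) ⊕ (b ⊕ d)
⊕-interchange [] [] [] [] = refl
⊕-interchange (a ∷ as) (b ∷ bs) (c ∷ cs) (d ∷ ds) =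
  cong₂ _∷_ (interchange a b c d) (⊕-interchange as bs cs ds)

∩-distribʳ-⊕ : (p x y : Vec Bool n) → (x ⊕ y) ∩ p ≡ (x ∩ p) ⊕ (y ∩ p)
∩-distribʳ-⊕ = zipWith-distribʳ Bool.∧-distribʳ-xor

parity-⊕ : ∀ T (x y : Vec Bool n) → parity T (x ⊕ y) ≡ parity T x xor parity T y
parity-⊕ [] [] [] = refl
parity-⊕ (t ∷ T) (a ∷ x) (b ∷ y) = trans
  (cong₂ _xor_ (Bool.∧-distribˡ-xor t a b) (parity-⊕ T x y))
  (interchange (t ∧ a) (t ∧ b) (parity T x) (parity T y))

⊕⁅⁆-invariant⇒constant : {A : Set} (g : Vec Bool n → A) →
  (∀ i x → g (x ⊕ ⁅ i ⁆) ≡ g x) → ∀ x → g x ≡ g ⊥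
⊕⁅⁆-invariant⇒constant g inv []      = refl
⊕⁅⁆-invariant⇒constant g inv (b ∷ x) = trans
  (⊕⁅⁆-invariant⇒constant (g ∘ (b ∷_))
    (λ i y → trans (cong (λ c → g (c ∷ y ⊕ ⁅ i ⁆)) (sym (Bool.xor-identityʳ b))) (inv (suc i) (b ∷ y))) x)
  (clear b)
  where
  clear : ∀ b → g (b ∷ ⊥) ≡ g ⊥
  clear false = refl
  clear true  = trans (cong (g ∘ (true ∷_)) (sym (⊕-identityʳ ⊥))) (inv zero ⊥)

Pair : ℕ → Set
Pair n = Vec Bool n × Vec Bool n

infixl 6 _⊞_

_⊞_ : Pair n → Pair n → Pair n
(a , b) ⊞ (a′ , b′) = a ⊕ a′ , b ⊕ b′

𝟘 : Pair n
𝟘 = ⊥ , ⊥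

⊞-identityʳ : (z : Pair n) → z ⊞ 𝟘 ≡ z
⊞-identityʳ (a , b) = cong₂ _,_ (⊕-identityʳ a) (⊕-identityʳ b)

⊞-interchange : (z w u v : Pair n) → (z ⊞ w) ⊞ (u ⊞ v) ≡ (z ⊞ u) ⊞ (w ⊞ v)
⊞-interchange (a , b) (c , d) (e , f) (g , h) =
  cong₂ _,_ (⊕-interchange a c e g) (⊕-interchange b d f h)

⊞-inverse : (z : Pair n) → z ⊞ z ≡ 𝟘
⊞-inverse (a , b) = cong₂ _,_ (⊕-inverse a) (⊕-inverse b)
  where
  ⊕-inverse : (x : Vec Bool n) → x ⊕ x ≡ ⊥
  ⊕-inverse []      = refl
  ⊕-inverse (c ∷ x) = cong₂ _∷_ (Bool.xor-same c) (⊕-inverse x)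

infixr 7 _·_

_·_ : Bool → Pair n → Pair n
true  · z = z
false · z = 𝟘

·-distribʳ : ∀ c d (z : Pair n) → (c xor d) · z ≡ c · z ⊞ d · z
·-distribʳ false false z = sym (⊞-identityʳ 𝟘)
·-distribʳ false true  (a , b) = cong₂ _,_ (⊕-identityˡ a) (⊕-identityˡ b)
  where
  ⊕-identityˡ : (x : Vec Bool n) → x ≡ ⊥ ⊕ x
  ⊕-identityˡ []      = refl
  ⊕-identityˡ (c ∷ x) = cong (c ∷_) (⊕-identityˡ x)
·-distribʳ true  false z = sym (⊞-identityʳ z)
·-distribʳ true  true  z = sym (⊞-inverse z)

meet : Pair n → Vec Bool n
meet (a , b) = a ∩ b

mask : Subset n → Pair n → Pair n
mask m (a , b) = a ∩ m , b ∩ m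

mask-⊞ : ∀ m (z w : Pair n) → mask m (z ⊞ w) ≡ mask m z ⊞ mask m w
mask-⊞ m (a , b) (c , d) = cong₂ _,_ (∩-distribʳ-⊕ m a c) (∩-distribʳ-⊕ m b d)

Invisible : Subset n → Pair n → Set
Invisible m (p , q) = p ∩ q ≡ ⊥ × p ∩ m ≡ ⊥ × q ∩ m ≡ ⊥

-- On `m` the pair `e` vanishes; off `m` the masked pair vanishes, and the meet there is that of
-- `e`, which is empty.
meet-mask-⊞ : ∀ m (z e : Pair n) → Invisible m e → meet (mask m z ⊞ e) ≡ meet z ∩ m
meet-mask-⊞ []       ([] , [])         ([] , [])         _              = refl
meet-mask-⊞ (m ∷ ms) (a ∷ as , b ∷ bs) (p ∷ ps , q ∷ qs) (pq , pm , qm) = cong₂ _∷_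
  (pointwise m a b p q (Vec.∷-injectiveˡ pq) (Vec.∷-injectiveˡ pm) (Vec.∷-injectiveˡ qm))
  (meet-mask-⊞ ms (as , bs) (ps , qs)
    (Vec.∷-injectiveʳ pq , Vec.∷-injectiveʳ pm , Vec.∷-injectiveʳ qm))
  where
  pointwise : ∀ m a b p q → p ∧ q ≡ false → p ∧ m ≡ false → q ∧ m ≡ false →
              (((a ∧ m) xor p) ∧ ((b ∧ m) xor q)) ≡ (a ∧ b) ∧ m
  pointwise true  a b false false _ _ _ rewrite Bool.∧-identityʳ a | Bool.∧-identityʳ b
    | Bool.xor-identityʳ a | Bool.xor-identityʳ b = sym (Bool.∧-identityʳ (a ∧ b))
  pointwise false a b p q pq _ _ rewrite Bool.∧-zeroʳ a | Bool.∧-zeroʳ b =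
    trans pq (sym (Bool.∧-zeroʳ (a ∧ b)))

·-invisible : ∀ {m} {e : Pair n} → Invisible m e → ∀ c → Invisible m (c · e)
·-invisible         inv true  = inv
·-invisible {m = m} inv false = ∩-zeroˡ ⊥ , ∩-zeroˡ m , ∩-zeroˡ m

i∉p⇒p∩∁⁅i⁆≡p : ∀ {i} {p : Subset n} → i ∉ p → p ∩ ∁ ⁅ i ⁆ ≡ p
i∉p⇒p∩∁⁅i⁆≡p {i = i} {p} i∉p = ⊆-antisym (p∩q⊆p p (∁ ⁅ i ⁆))
  λ j∈p → x∈p∩q⁺ (j∈p , x∉p⇒x∈∁p (x≢y⇒x∉⁅y⁆ λ { refl → i∉p j∈p }))

-- An affine map over the two-element field, with `slope` as its linear part; the equation for all
-- `z` and `w` forces `slope` to be additive.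
record Affine (σ : Pair n → Vec Bool N) : Set where
  field
    slope   : Pair n → Vec Bool N
    slope-⊞ : ∀ z w → σ (z ⊞ w) ≡ σ z ⊕ slope w

++-affine : Affine {n} (λ (a , b) → a ++ᵛ b)
++-affine = record
  { slope   = λ (a , b) → a ++ᵛ b
  ; slope-⊞ = λ (a , b) (c , d) → sym (zipWith-++ _xor_ a b c d)
  }

module _ {σ : Pair n → Vec Bool N} (σ-affine : Affine σ) (T : Subset N) where
  open Affine σ-affine

  φ : Pair n → Bool
  φ z = parity T (σ z)

  φ-⊞ : ∀ z w → φ (z ⊞ w) ≡ φ z xor parity T (slope w)
  φ-⊞ z w = trans (cong (parity T) (slope-⊞ z w)) (parity-⊕ T (σ z) (slope w))

  -- The direction `e` moves just one of the two bits of the `i`-th pair, and moving along it flips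
  -- the queried parity.
  Pivot : Fin n → Pair n → Set
  Pivot i e = Invisible (∁ ⁅ i ⁆) e × parity T (slope e) ≡ true

  -- The single-bit directions span all pairs. If none of them flips the parity, any `z` can be
  -- cleared bit by bit down to `𝟘` without changing the answer.
  pivot⊎constant : ∃₂ Pivot ⊎ (∀ z → φ z ≡ φ 𝟘)
  pivot⊎constant
    with any? (λ i → parity T (slope (⁅ i ⁆ , ⊥)) Bool.≟ true)
       | any? (λ i → parity T (slope (⊥ , ⁅ i ⁆)) Bool.≟ true)
  ... | yes (i , eq) | _ =
    inj₁ (i , (⁅ i ⁆ , ⊥) , (∩-zeroʳ ⁅ i ⁆ , ∩-inverseʳ ⁅ i ⁆ , ∩-zeroˡ (∁ ⁅ i ⁆)) , eq)
  ... | no _ | yes (i , eq) =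
    inj₁ (i , (⊥ , ⁅ i ⁆) , (∩-zeroˡ ⁅ i ⁆ , ∩-zeroˡ (∁ ⁅ i ⁆) , ∩-inverseʳ ⁅ i ⁆) , eq)
  ... | no noneˡ | no noneʳ = inj₂ λ (a , b) → trans
    (⊕⁅⁆-invariant⇒constant (λ a → φ (a , b)) (λ i a → trans
      (cong (λ b → φ (a ⊕ ⁅ i ⁆ , b)) (sym (⊕-identityʳ b)))
      (fixed (λ eq → noneˡ (i , eq)) (a , b))) a)
    (⊕⁅⁆-invariant⇒constant (λ b → φ (⊥ , b)) (λ i b → trans
      (cong (λ a → φ (a , b ⊕ ⁅ i ⁆)) (sym (⊕-identityʳ ⊥)))
      (fixed (λ eq → noneʳ (i , eq)) (⊥ , b))) b)
    where
    fixed : ∀ {e} → parity T (slope e) ≢ true → ∀ z → φ (z ⊞ e) ≡ φ z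
    fixed {e} ≢true z = trans (φ-⊞ z e)
      (trans (cong (φ z xor_) (Bool.¬-not ≢true)) (Bool.xor-identityʳ (φ z)))

  module _ {i} {e : Pair n} (pivot : Pivot i e) where

    erase : Pair n → Pair n
    erase = mask (∁ ⁅ i ⁆)

    -- Both bits of pair `i` are set to 0, and one of them is then chosen through `e` so that the
    -- parity becomes false. The other bit stays 0, so bit `i` of the meet is 0 whichever correction
    -- is made.
    project : Pair n → Pair n
    project z = erase z ⊞ φ (erase z) · e

    φ-project : ∀ z → φ (project z) ≡ false
    φ-project z with φ (erase z) in eq
    ... | true  = trans (φ-⊞ (erase z) e) (cong₂ _xor_ eq (proj₂ pivot))
    ... | false = trans (cong φ (⊞-identityʳ (erase z))) eq

    meet-project : ∀ z → i ∉ meet z → meet (project z) ≡ meet z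
    meet-project z i∉z = trans
      (meet-mask-⊞ (∁ ⁅ i ⁆) z _ (·-invisible (proj₁ pivot) (φ (erase z))))
      (i∉p⇒p∩∁⁅i⁆≡p i∉z)

    project-affine : Affine (σ ∘ project)
    project-affine = record
      -- The correction coefficient is affine in the input; in the linear part its constant term
      -- drops out, leaving the parity of the slope.
      { slope   = λ w → slope (erase w ⊞ parity T (slope (erase w)) · e)
      ; slope-⊞ = λ z w → trans (cong σ (project-⊞ z w)) (slope-⊞ (project z) _)
      }
      where
      project-⊞ : ∀ z w →
        project (z ⊞ w) ≡ project z ⊞ (erase w ⊞ parity T (slope (erase w)) · e)
      project-⊞ z w = begin
        project (z ⊞ w)
          ≡⟨ cong (λ u → u ⊞ φ u · e) (mask-⊞ (∁ ⁅ i ⁆) z w) ⟩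
        erase z ⊞ erase w ⊞ φ (erase z ⊞ erase w) · e
          ≡⟨ cong (λ c → erase z ⊞ erase w ⊞ c · e) (φ-⊞ (erase z) (erase w)) ⟩
        erase z ⊞ erase w ⊞ (φ (erase z) xor c) · e
          ≡⟨ cong (erase z ⊞ erase w ⊞_) (·-distribʳ (φ (erase z)) c e) ⟩
        erase z ⊞ erase w ⊞ (φ (erase z) · e ⊞ c · e)
          ≡⟨ ⊞-interchange (erase z) (erase w) (φ (erase z) · e) (c · e) ⟩
        project z ⊞ (erase w ⊞ c · e)
          ∎
        where
        open ≡-Reasoning
        c = parity T (slope (erase w))

-- By disjointness at most one block contains `i`. That block is dropped, or the last one if there
-- is none, so the count falls by exactly one; `keep` records that `Cs` is a subfamily.
avoid : ∀ i {Bs : Vec (Subset n) (suc k)} → AllPairs Disjoint Bs →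
  ∃[ Cs ] AllPairs Disjoint {k} Cs × All (i ∉_) Cs ×
          (∀ {P : Subset n → Set} → All P Bs → All P Cs)
avoid i {B ∷ Bs} (dis ∷ diss) with i ∈? B
... | yes i∈B = Bs , diss , All.map (λ B∩C≡∅ i∈C → B∩C≡∅ (i , x∈p∩q⁺ (i∈B , i∈C))) dis , All.tail
avoid i {B ∷ []}     _            | no _   = [] , [] , [] , λ _ → []
avoid i {B ∷ _ ∷ _}  (dis ∷ diss) | no i∉B =
  let Cs , diss′ , i∉Cs , keep = avoid i diss
  in B ∷ Cs , keep dis ∷ diss′ , i∉B ∷ i∉Cs , λ { (p ∷ ps) → p ∷ keep ps }

output-node : ∀ (T : Subset N) t₀ t₁ {x c} → parity T x ≡ c →
              output (node T t₀ t₁) x ≡ (if c then output t₁ x else output t₀ x)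
output-node T t₀ t₁ {x} = cong λ c → if c then output t₁ x else output t₀ x

-- The cases of interest are `y = ⊥` and `y = B`: the tree gives one output to inputs with these two
-- meets. Ranging over all `y ⊆ B` ensures that `i ∉ B` keeps a pivot `i` out of every such meet.
Blind : ParityTree N → (Pair n → Vec Bool N) → Subset n → Set
Blind t σ B = ∃[ v ] ∀ {y} → y ⊆ B → ∃[ z ] meet z ≡ y × output t (σ z) ≡ v

-- Induction on the tree. At a pivot the family is narrowed to inputs answering false, losing one
-- block for one level of depth. A parity constant on the family determines the branch and loses no
-- block. The strict inequality leaves a block at the leaf.
blind-block : ∀ t {σ : Pair n → Vec Bool N} → Affine σ →
  ∀ {k} {P : Subset n → Set} {Bs : Vec (Subset n) k} → AllPairs Disjoint Bs → All P Bs →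
  depth t < k → ∃[ B ] P B × Blind t σ B
blind-block (leaf b) σ-affine {Bs = B ∷ _} _ (p ∷ _) _ =
  -- The diagonal pair `(y , y)` has meet `y`, and a leaf has a fixed output.
  B , p , b , λ {y} _ → (y , y) , ∩-idem y , refl
blind-block (node T t₀ t₁) {σ} σ-affine {suc k} dis ps (s≤s t<k) with pivot⊎constant σ-affine T
... | inj₁ (i , e , pivot) =
  let Cs , dis′ , i∉Cs , keep = avoid i dis
      -- The general predicate `P` is strengthened by `i ∉_`, so that the surviving block is known
      -- to avoid this pivot; then `project` preserves the meets inside it.
      B , (p , i∉B) , v , blind = blind-block t₀ (project-affine σ-affine T pivot) dis′
        (All.zip (keep ps , i∉Cs)) (ℕ.≤-<-trans (ℕ.m≤m⊔n _ _) t<k)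
  in B , p , v , λ y⊆B →
    let z , z≡y , out≡v = blind y⊆B
    in project σ-affine T pivot z
     , trans (meet-project σ-affine T pivot z (λ i∈z → i∉B (y⊆B (subst (i ∈_) z≡y i∈z)))) z≡y
     , trans (output-node T t₀ t₁ (φ-project σ-affine T pivot z)) out≡v
... | inj₂ constant with φ σ-affine T 𝟘
...   | false =
  let B , p , v , blind = blind-block t₀ σ-affine dis ps (ℕ.m≤n⇒m≤1+n (ℕ.≤-<-trans (ℕ.m≤m⊔n _ _) t<k))
  in B , p , v , λ y⊆B → let z , z≡y , out≡v = blind y⊆B in
    z , z≡y , trans (output-node T t₀ t₁ (constant z)) out≡v
...   | true =
  let B , p , v , blind = blind-block t₁ σ-affine dis ps (ℕ.m≤n⇒m≤1+n (ℕ.≤-<-trans (ℕ.m≤n⊔m _ _) t<k))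
  in B , p , v , λ y⊆B → let z , z≡y , out≡v = blind y⊆B in
    z , z≡y , trans (output-node T t₀ t₁ (constant z)) out≡v

-- Composition with AND

halves : Vec Bool (n + n) → Pair n
halves {n} z = take n z , drop n z

halves-++ : (a b : Vec Bool n) → halves (a ++ᵛ b) ≡ (a , b)
halves-++ {n} a b = cong₂ _,_
  (++-injectiveˡ (take n (a ++ᵛ b)) a (take++drop≡id n (a ++ᵛ b)))
  (++-injectiveʳ (take n (a ++ᵛ b)) a (take++drop≡id n (a ++ᵛ b)))

shiftedAnd : BoolFun n → Vec Bool n → BoolFun (n + n)
shiftedAnd f x z = f (x ⊕ meet (halves z))

shiftedAnd-++ : (f : BoolFun n) (x a b : Vec Bool n) → shiftedAnd f x (a ++ᵛ b) ≡ f (x ⊕ (a ∩ b))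
shiftedAnd-++ f x a b = cong (λ z → f (x ⊕ meet z)) (halves-++ a b)

-- A tree of depth below the number of blocks would be blind to some sensitive `B`. Correctness on
-- inputs with meets `⊥` and `B` then gives `f x` and `f (x ⊕ B)` the same value.
blockSensitivityAt≤D⊕ : (f : BoolFun n) (x : Vec Bool n) →
                        blockSensitivityAt f x ≤ D⊕ (shiftedAnd f x)
blockSensitivityAt≤D⊕ {n} f x = ℕ.≮⇒≥ λ D<bs →
  let t , t≡D , computes = Minimum.attained (minDepth (shiftedAnd f x))
      Bs , sens , dis = Maximum.attained (maxSensitiveFamily f x)
      B , sensitive , v , blind =
        blind-block t ++-affine dis sens (subst (_< blockSensitivityAt f x) (sym t≡D) D<bs)
      f≡v : ∀ {y} → y ⊆ B → f (x ⊕ y) ≡ v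
      f≡v = λ {y} y⊆B → let (a , b) , a∩b≡y , out≡v = blind y⊆B in
        trans (cong (λ y → f (x ⊕ y)) (sym a∩b≡y))
          (trans (sym (shiftedAnd-++ f x a b)) (trans (sym (computes (a ++ᵛ b))) out≡v))
  in sensitive (trans (f≡v ⊆-refl) (trans (sym (f≡v ⊥⊆)) (cong f (⊕-identityʳ x))))

tabulate-+ : ∀ {A : Set} m (g : Fin (m + n) → A) →
  List.tabulate g ≡ List.tabulate (g ∘ (_↑ˡ n)) ++ List.tabulate (g ∘ (m ↑ʳ_))
tabulate-+ zero    g = refl
tabulate-+ (suc m) g = cong (g zero ∷_) (tabulate-+ m (g ∘ suc))

length-filter-tabulate : ∀ {A C : Set} {P : A → Set} {Q : C → Set}
  (P? : Decidable P) (Q? : Decidable Q) {m} (g : Fin m → A) (h : Fin m → C) →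
  (∀ i → P (g i) → Q (h i)) →
  length (filter P? (List.tabulate g)) ≤ length (filter Q? (List.tabulate h))
length-filter-tabulate P? Q? {zero}  g h P⇒Q = z≤n
length-filter-tabulate P? Q? {suc m} g h P⇒Q
  with ih ← length-filter-tabulate P? Q? (g ∘ suc) (h ∘ suc) (P⇒Q ∘ suc) | P? (g zero) | Q? (h zero)
... | yes p | yes q = s≤s ih
... | yes p | no ¬q = contradiction (P⇒Q zero p) ¬q
... | no ¬p | yes q = ℕ.m≤n⇒m≤1+n ih
... | no ¬p | no ¬q = ih

⊥++⊥≡⊥ : ∀ m → ⊥ {m} ++ᵛ ⊥ {n} ≡ ⊥
⊥++⊥≡⊥ zero    = refl
⊥++⊥≡⊥ (suc m) = cong (false ∷_) (⊥++⊥≡⊥ m)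

⁅i↑ˡn⁆ : ∀ (i : Fin k) → ⁅ i ↑ˡ n ⁆ ≡ ⁅ i ⁆ ++ᵛ ⊥
⁅i↑ˡn⁆ {suc k} zero    = cong (true ∷_) (sym (⊥++⊥≡⊥ k))
⁅i↑ˡn⁆         (suc i) = cong (false ∷_) (⁅i↑ˡn⁆ i)

⁅k↑ʳi⁆ : ∀ k (i : Fin n) → ⁅ k ↑ʳ i ⁆ ≡ ⊥ {k} ++ᵛ ⁅ i ⁆
⁅k↑ʳi⁆ zero    i = refl
⁅k↑ʳi⁆ (suc k) i = cong (false ∷_) (⁅k↑ʳi⁆ k i)

⁅i⁆∩p≡⊥⊎⁅i⁆ : ∀ i (p : Subset n) → ⁅ i ⁆ ∩ p ≡ ⊥ ⊎ ⁅ i ⁆ ∩ p ≡ ⁅ i ⁆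
⁅i⁆∩p≡⊥⊎⁅i⁆ zero    (false ∷ p) = inj₁ (cong (false ∷_) (∩-zeroˡ p))
⁅i⁆∩p≡⊥⊎⁅i⁆ zero    (true  ∷ p) = inj₂ (cong (true ∷_) (∩-zeroˡ p))
⁅i⁆∩p≡⊥⊎⁅i⁆ (suc i) (_ ∷ p) = Sum.map (cong (false ∷_)) (cong (false ∷_)) (⁅i⁆∩p≡⊥⊎⁅i⁆ i p)

module _ (f : BoolFun n) (x : Vec Bool n) where

  -- Flipping bit `i` of `a` either leaves `a ∩ b` unchanged or flips exactly its bit `i`, according
  -- to bit `i` of `b`.
  insensitiveˡ : ∀ a b i → f (x ⊕ (a ∩ b) ⊕ ⁅ i ⁆) ≡ f (x ⊕ (a ∩ b)) →
                 f (x ⊕ ((a ⊕ ⁅ i ⁆) ∩ b)) ≡ f (x ⊕ (a ∩ b))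
  insensitiveˡ a b i insens rewrite ∩-distribʳ-⊕ b a ⁅ i ⁆ with ⁅i⁆∩p≡⊥⊎⁅i⁆ i b
  ... | inj₁ eq rewrite eq = cong (f ∘ (x ⊕_)) (⊕-identityʳ (a ∩ b))
  ... | inj₂ eq rewrite eq = trans (cong f (sym (⊕-assoc x (a ∩ b) ⁅ i ⁆))) insens

  sensitiveˡ : ∀ a b i → Sensitive (shiftedAnd f x) (a ++ᵛ b) ⁅ i ↑ˡ n ⁆ →
               Sensitive f (x ⊕ (a ∩ b)) ⁅ i ⁆
  sensitiveˡ a b i sens insens = sens (begin
    shiftedAnd f x ((a ++ᵛ b) ⊕ ⁅ i ↑ˡ n ⁆)
      ≡⟨ cong (shiftedAnd f x ∘ ((a ++ᵛ b) ⊕_)) (⁅i↑ˡn⁆ i) ⟩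
    shiftedAnd f x ((a ++ᵛ b) ⊕ (⁅ i ⁆ ++ᵛ ⊥))
      ≡⟨ cong (shiftedAnd f x) (zipWith-++ _xor_ a b ⁅ i ⁆ ⊥) ⟩
    shiftedAnd f x ((a ⊕ ⁅ i ⁆) ++ᵛ (b ⊕ ⊥))
      ≡⟨ shiftedAnd-++ f x (a ⊕ ⁅ i ⁆) (b ⊕ ⊥) ⟩
    f (x ⊕ ((a ⊕ ⁅ i ⁆) ∩ (b ⊕ ⊥)))
      ≡⟨ cong (λ b → f (x ⊕ ((a ⊕ ⁅ i ⁆) ∩ b))) (⊕-identityʳ b) ⟩
    f (x ⊕ ((a ⊕ ⁅ i ⁆) ∩ b))
      ≡⟨ insensitiveˡ a b i insens ⟩
    f (x ⊕ (a ∩ b))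
      ≡⟨ shiftedAnd-++ f x a b ⟨
    shiftedAnd f x (a ++ᵛ b) ∎)
    where open ≡-Reasoning

  -- The meet is symmetric in the two halves, so swapping them reduces this to `insensitiveˡ`.
  sensitiveʳ : ∀ a b i → Sensitive (shiftedAnd f x) (a ++ᵛ b) ⁅ n ↑ʳ i ⁆ →
               Sensitive f (x ⊕ (a ∩ b)) ⁅ i ⁆
  sensitiveʳ a b i sens insens = sens (begin
    shiftedAnd f x ((a ++ᵛ b) ⊕ ⁅ n ↑ʳ i ⁆)
      ≡⟨ cong (shiftedAnd f x ∘ ((a ++ᵛ b) ⊕_)) (⁅k↑ʳi⁆ n i) ⟩
    shiftedAnd f x ((a ++ᵛ b) ⊕ (⊥ ++ᵛ ⁅ i ⁆))
      ≡⟨ cong (shiftedAnd f x) (zipWith-++ _xor_ a b ⊥ ⁅ i ⁆) ⟩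
    shiftedAnd f x ((a ⊕ ⊥) ++ᵛ (b ⊕ ⁅ i ⁆))
      ≡⟨ shiftedAnd-++ f x (a ⊕ ⊥) (b ⊕ ⁅ i ⁆) ⟩
    f (x ⊕ ((a ⊕ ⊥) ∩ (b ⊕ ⁅ i ⁆)))
      ≡⟨ cong (λ a → f (x ⊕ (a ∩ (b ⊕ ⁅ i ⁆)))) (⊕-identityʳ a) ⟩
    f (x ⊕ (a ∩ (b ⊕ ⁅ i ⁆)))
      ≡⟨ cong (f ∘ (x ⊕_)) (∩-comm a (b ⊕ ⁅ i ⁆)) ⟩
    f (x ⊕ ((b ⊕ ⁅ i ⁆) ∩ a))
      ≡⟨ insensitiveˡ b a i (subst (λ y → f (x ⊕ y ⊕ ⁅ i ⁆) ≡ f (x ⊕ y)) (∩-comm a b) insens) ⟩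
    f (x ⊕ (b ∩ a))
      ≡⟨ cong (f ∘ (x ⊕_)) (∩-comm b a) ⟩
    f (x ⊕ (a ∩ b))
      ≡⟨ shiftedAnd-++ f x a b ⟨
    shiftedAnd f x (a ++ᵛ b) ∎)
    where open ≡-Reasoning

  -- A sensitive bit in either half comes from a sensitive coordinate of `f` at `x ⊕ (a ∩ b)`, and
  -- each such coordinate is counted at most once per half.
  s-shiftedAnd : s (shiftedAnd f x) ≤ s f + s f
  s-shiftedAnd = cubeMax-lub (sensitivityAt (shiftedAnd f x)) λ z →
    subst (λ z → sensitivityAt (shiftedAnd f x) z ≤ s f + s f) (take++drop≡id n z)
      (at-++ (take n z) (drop n z))
    where
    open ℕ.≤-Reasoning
    at-++ : ∀ a b → sensitivityAt (shiftedAnd f x) (a ++ᵛ b) ≤ s f + s f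
    at-++ a b = begin
      length (filter h? (allFin (n + n)))
        ≡⟨ cong (length ∘ filter h?) (tabulate-+ n id) ⟩
      length (filter h? (left ++ right))
        ≡⟨ cong length (filter-++ h? left right) ⟩
      length (filter h? left ++ filter h? right)
        ≡⟨ length-++ (filter h? left) ⟩
      length (filter h? left) + length (filter h? right)
        ≤⟨ ℕ.+-mono-≤
             (length-filter-tabulate h? f? (_↑ˡ n) id (sensitiveˡ a b))
             (length-filter-tabulate h? f? (n ↑ʳ_) id (sensitiveʳ a b)) ⟩
      sensitivityAt f (x ⊕ (a ∩ b)) + sensitivityAt f (x ⊕ (a ∩ b))
        ≤⟨ ℕ.+-mono-≤ (cubeMax-upper (sensitivityAt f) (x ⊕ (a ∩ b)))
                      (cubeMax-upper (sensitivityAt f) (x ⊕ (a ∩ b))) ⟩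
      s f + s f ∎
      where
      h? = λ j → sensitive? (shiftedAnd f x) (a ++ᵛ b) ⁅ j ⁆
      f? = λ i → sensitive? f (x ⊕ (a ∩ b)) ⁅ i ⁆
      left  = List.tabulate (_↑ˡ n)
      right = List.tabulate (n ↑ʳ_)

-- Polynomial bounds in both directions

theorem4p2p2 : (Σ[ p ∈ Polynomial ] ∀ n → 1 ≤ n → (f : BoolFun n) → fromℕ (bs f) ≤ᵣ ⟦ p ⟧ (fromℕ (s f)))
    ⇔ (Σ[ q ∈ Polynomial ] ∀ n → 1 ≤ n → (f : BoolFun n) → fromℕ (D⊕ f) ≤ᵣ ⟦ q ⟧ (fromℕ (s f)))
theorem4p2p2 = mk⇔
  (λ (p , bs≤p) →
    -- The list `0 ∷ 1 ∷ []` is the polynomial X, so `c` bounds `bs f * s f` and its square bounds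
    -- `D⊕ f`.
    let c = majorant p *ᴾ (0 ∷ 1 ∷ [])
    in map fromℕ (c *ᴾ c) , λ n 1≤n f → ≤⇒≤ᵣ (c *ᴾ c) (D⊕-bound (majorant p) f (≤ᵣ⇒≤ p (bs≤p n 1≤n f))))
  (λ (q , D⊕≤q) →
    -- The list `0 ∷ 2 ∷ []` is 2X, matching the doubled sensitivity of `shiftedAnd f x`.
    let d = majorant q ∘ᴾ (0 ∷ 2 ∷ [])
    in map fromℕ d , λ n 1≤n f → ≤⇒≤ᵣ d (bs-bound (majorant q) f λ x →
         ≤ᵣ⇒≤ q (D⊕≤q (n + n) (ℕ.≤-trans 1≤n (ℕ.m≤m+n n n)) (shiftedAnd f x))))
  where
  open ℕ.≤-Reasoning

  D⊕-bound : ∀ cs (f : BoolFun n) → bs f ≤ eval cs (s f) →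
    let c = cs *ᴾ (0 ∷ 1 ∷ []) in D⊕ f ≤ eval (c *ᴾ c) (s f)
  D⊕-bound cs f bs≤ = begin
    D⊕ f                          ≤⟨ D⊕≤[bs*s]² f ⟩
    bs f * s f * (bs f * s f)     ≤⟨ ℕ.*-mono-≤ bs*s≤ bs*s≤ ⟩
    eval c (s f) * eval c (s f)   ≡⟨ eval-* c c (s f) ⟨
    eval (c *ᴾ c) (s f)           ∎
    where
    c = cs *ᴾ (0 ∷ 1 ∷ [])
    eval-X : ∀ m → m ≡ m * (1 + m * 0)
    eval-X = solve-∀
    bs*s≤ : bs f * s f ≤ eval c (s f)
    bs*s≤ = begin
      bs f * s f                                  ≤⟨ ℕ.*-mono-≤ bs≤ (ℕ.≤-reflexive (eval-X (s f))) ⟩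
      eval cs (s f) * eval (0 ∷ 1 ∷ []) (s f)     ≡⟨ eval-* cs (0 ∷ 1 ∷ []) (s f) ⟨
      eval c (s f)                                ∎

  bs-bound : ∀ ds (f : BoolFun n) →
    (∀ x → D⊕ (shiftedAnd f x) ≤ eval ds (s (shiftedAnd f x))) →
    bs f ≤ eval (ds ∘ᴾ (0 ∷ 2 ∷ [])) (s f)
  bs-bound ds f D⊕≤ = cubeMax-lub (blockSensitivityAt f) λ x → begin
    blockSensitivityAt f x              ≤⟨ blockSensitivityAt≤D⊕ f x ⟩
    D⊕ (shiftedAnd f x)                 ≤⟨ D⊕≤ x ⟩
    eval ds (s (shiftedAnd f x))        ≤⟨ eval-mono ds (s-shiftedAnd f x) ⟩
    eval ds (s f + s f)                 ≡⟨ cong (eval ds) (eval-2X (s f)) ⟩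
    eval ds (eval (0 ∷ 2 ∷ []) (s f))   ≡⟨ eval-∘ ds (0 ∷ 2 ∷ []) (s f) ⟨
    eval (ds ∘ᴾ (0 ∷ 2 ∷ [])) (s f)     ∎
    where
    eval-2X : ∀ m → m + m ≡ m * (2 + m * 0)
    eval-2X = solve-∀
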